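{- Let $0<p\le 1$, $q=1-p$, and consider the single-player pile game with boundary with set of choices $R=\{1,-1\}$, with generating functions $G_{n,s}(x)$, $0\le s\le n$. For $0\le s\le n$ write $G_{n,s}(x)=\dfrac{P_{n,s}(x)}{Q_n(x)}$, where $Q_n(x)$ is the common denominator (independent of $s$), normalized so that the numerator of $G_{n,0}(x)$ is $P_{n,0}(x)=(px)^n$, and the $P_{n,s}(x)$ are polynomials. Then $Q_n(x)$ satisfies $$Q_n(x)=Q_{n-1}(x)-qp\,x^2\,Q_{n-2}(x)\qquad(n\ge2),$$ with $Q_0(x)=1$ and $Q_1(x)=1-qx$.
   Context: Single-player pile game with boundary, $R=\{1,-1\}$: the player starts with $s$ chips, $0\le s\le n$. In each turn, independently, with probability $p$ one chip is added, and with probability $q=1-p$ one chip is removed, except that if the player has $0$ chips he stays at $0$ instead. The game ends when the player first has $n$ chips (at turn $0$ if $s=n$). $B_n(k,s)$ is the probability that the game ends at the $k$-th turn, and $G_{n,s}(x)=\sum_{k\ge0}B_n(k,s)x^k$. In particular $G_{n,n}(x)=1$ for all $n\ge0$. The functions $G_{n,s}(x)$, $0\le s\le n$, are rational with a common denominator. -}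

module Defs where

open import Algebra.Apartness.Bundles using (HeytingField)
open import Algebra.Bundles.Raw using (RawRing)
import Algebra.Definitions.RawMonoid as RawMonoidDefs
import Algebra.Definitions.RawSemiring as RawSemiringDefs
open import Data.Bool.Base using (if_then_else_)
open import Data.Fin.Base using (toℕ)
open import Data.Nat.Base as ℕ using (ℕ; zero; suc; pred; _∸_)
import Data.Nat.Properties as ℕₚ
open import Data.Product.Base using (∃-syntax)
open import Data.Sum.Base using (_⊎_)
open import Data.Vec.Base using (Vec; []; _∷_)
open import Function.Base using (_∘_)
open import Level as Level using (_⊔_)
open import Relation.Binary.Core using (Rel)
open import Relation.Binary.PropositionalEquality.Core using (_≢_; refl)
open import Relation.Binary.Structures using (IsStrictPartialOrder)
open import Relation.Nullary.Decidable.Core using (Dec; yes; no; does)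
open import Relation.Nullary.Negation.Core using (¬_)
open import Relation.Unary using (Pred; Decidable)

-- The real numbers are not in the library, so probabilities live in an
-- arbitrary ordered field.  The axioms below hold for the real numbers, both
-- classically (with x # y taken to be ¬ x ≈ y) and constructively.  The order
-- is total in the sense natural for _#_: apart elements are comparable.

record OrderedField c ℓ₁ ℓ₂ ℓ₃ : Set (Level.suc (c ⊔ ℓ₁ ⊔ ℓ₂ ⊔ ℓ₃)) where
  infix 4 _<_ _≤_
  field
    heytingField : HeytingField c ℓ₁ ℓ₂

  open HeytingField heytingField public

  field
    _<_                  : Rel Carrier ℓ₃
    isStrictPartialOrder : IsStrictPartialOrder _≈_ _<_
    #⇒<⊎>                : ∀ {x y} → x # y → x < y ⊎ y < x
    <⇒#                  : ∀ {x y} → x < y → x # y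
    +-monoʳ-<            : ∀ x {y z} → y < z → x + y < x + z
    *-pos                : ∀ {x y} → 0# < x → 0# < y → 0# < x * y

  _≤_ : Rel Carrier ℓ₃
  x ≤ y = ¬ (y < x)

  rawRing : RawRing c ℓ₁
  rawRing = record
    { _≈_ = _≈_ ; _+_ = _+_ ; _*_ = _*_ ; -_ = -_ ; 0# = 0# ; 1# = 1# }

data Choice : Set where
  add remove : Choice

-- pred 0 is 0, which is the boundary rule.
move : Choice → ℕ → ℕ
move add    s = suc s
move remove s = pred s

-- EndsAt n s ω, with ω of length k: when the successive choices from s chips
-- are those of ω (first turn first), the number of chips is n for the first
-- time after turn k.
data EndsAt (n : ℕ) : ∀ {k} → ℕ → Vec Choice k → Set where
  done : EndsAt n n []
  turn : ∀ {k s c} {ω : Vec Choice k} →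
         s ≢ n → EndsAt n (move c s) ω → EndsAt n s (c ∷ ω)

endsAt? : ∀ n {k} s (ω : Vec Choice k) → Dec (EndsAt n s ω)
endsAt? n s [] with s ℕₚ.≟ n
... | yes refl = yes done
... | no  s≢n  = no λ { done → s≢n refl }
endsAt? n s (c ∷ ω) with s ℕₚ.≟ n | endsAt? n (move c s) ω
... | yes s≡n | _      = no λ { (turn s≢n _) → s≢n s≡n }
... | no  s≢n | yes e  = yes (turn s≢n e)
... | no  _   | no  ¬e = no λ { (turn _ e) → ¬e e }

-- Formal power series, given by their coefficients.  Polynomials are the
-- series with finitely many non-zero coefficients.

module PowerSeries {c ℓ₁ ℓ₂ ℓ₃} (F : OrderedField c ℓ₁ ℓ₂ ℓ₃) where
  open OrderedField F
  open RawMonoidDefs (RawRing.+-rawMonoid rawRing) using (sum)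

  Series : Set c
  Series = ℕ → Carrier

  infix  4 _≋_
  infixl 6 _⊕_ _⊖_
  infixl 7 _⊛_
  infixr 8 _↑_

  _≋_ : Rel Series ℓ₁
  f ≋ g = ∀ k → f k ≈ g k

  const : Carrier → Series
  const a zero      = a
  const a (suc _) = 0#

  X : Series
  X 1 = 1#
  X _ = 0#

  _⊕_ _⊖_ _⊛_ : Series → Series → Series
  (f ⊕ g) k = f k + g k
  (f ⊖ g) k = f k - g k
  (f ⊛ g) k = sum {n = suc k} λ i → f (toℕ i) * g (k ∸ toℕ i)

  seriesRawRing : RawRing c ℓ₁
  seriesRawRing = record
    { _≈_ = _≋_
    ; _+_ = _⊕_
    ; _*_ = _⊛_
    ; -_  = λ f k → - f k
    ; 0#  = const 0#
    ; 1#  = const 1#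
    }

  _↑_ : Series → ℕ → Series
  _↑_ = RawSemiringDefs._^_ (RawRing.rawSemiring seriesRawRing)

  IsPolynomial : Pred Series ℓ₁
  IsPolynomial f = ∃[ d ] (∀ k → d ℕ.< k → f k ≈ 0#)

  IsNonZero : Pred Series ℓ₂
  IsNonZero f = ∃[ k ] f k # 0#

module PileGame {c ℓ₁ ℓ₂ ℓ₃} (F : OrderedField c ℓ₁ ℓ₂ ℓ₃)
                (p : OrderedField.Carrier F) where
  open OrderedField F
  open PowerSeries F

  q : Carrier
  q = 1# - p

  choiceProb : Choice → Carrier
  choiceProb add    = p
  choiceProb remove = q

  outcomeProb : ∀ {k} → Vec Choice k → Carrier
  outcomeProb []      = 1#
  outcomeProb (c ∷ ω) = choiceProb c * outcomeProb ω

  sumOutcomes : ∀ k → (Vec Choice k → Carrier) → Carrier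
  sumOutcomes zero      f = f []
  sumOutcomes (suc k) f =
    sumOutcomes k (f ∘ (add ∷_)) + sumOutcomes k (f ∘ (remove ∷_))

  -- The probability of an event that depends on the first k choices only.
  Pr : ∀ {ℓ} k {A : Pred (Vec Choice k) ℓ} → Decidable A → Carrier
  Pr k A? = sumOutcomes k λ ω → if does (A? ω) then outcomeProb ω else 0#

  B : (n k s : ℕ) → Carrier
  B n k s = Pr k (endsAt? n s)

  G : (n s : ℕ) → Series
  G n s k = B n k s

  -- G n s = P n s / Q n for 0 ≤ s ≤ n, with the normalisation P n 0 = (p x)ⁿ.
  -- Equality of fractions is expressed in the ring of power series.
  record IsNormalisedFraction (P : ℕ → ℕ → Series) (Q : ℕ → Series)
         : Set (ℓ₁ ⊔ ℓ₂) where
    field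
      numerator-polynomial   : ∀ {n s} → s ℕ.≤ n → IsPolynomial (P n s)
      denominator-polynomial : ∀ n → IsPolynomial (Q n)
      denominator-nonZero    : ∀ n → IsNonZero (Q n)
      fraction               : ∀ {n s} → s ℕ.≤ n → Q n ⊛ G n s ≋ P n s
      normalised             : ∀ n → P n 0 ≋ (const p ⊛ X) ↑ n

-- Write Y = p x, Z = q x, and let D be the sequence given by the claimed recurrence.
-- Conditioning on the first turn gives G n s = Y G n (s+1) + Z G n (s-1) for s < n (with
-- 0 - 1 = 0), and this system together with the value at s = n has a unique solution, since
-- it determines each coefficient from the preceding ones.  Both s ↦ D n · G n s and
-- s ↦ Yⁿ⁻ˢ · D s solve it with the value D n at s = n, so D is a common denominator.  For any
-- other Q normalised in the same way, Yⁿ Q n = D n · G n 0 · Q n = Yⁿ D n, and Y is cancellable.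
module Submission where

open import Defs
open import Algebra.Apartness.Bundles using (HeytingCommutativeRing)
import Algebra.Apartness.Properties.HeytingCommutativeRing as HeytingProperties
open import Algebra.Bundles using (CommutativeRing; CommutativeSemiring)
open import Algebra.Structures.Biased using (isCommutativeSemiringˡ)
import Algebra.Solver.Ring.NaturalCoefficients.Default as SemiringSolver
open import Data.Bool.Base using (true; false; if_then_else_)
open import Data.Nat.Base as ℕ using (ℕ; zero; suc; pred; _∸_; z≤n; s≤s)
import Data.Nat.Properties as ℕₚ
open import Data.Product.Base using (_×_; ∃₂; _,_)
open import Data.Sum.Base using (inj₁; inj₂)
open import Data.Vec.Base using (Vec; []; _∷_)
open import Function.Base using (_∘_)
open import Function.Bundles using (mk⇔)
open import Relation.Binary.PropositionalEquality.Core as ≡ using (_≡_; _≢_)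
import Relation.Binary.Reasoning.Setoid as SetoidReasoning
open import Relation.Binary.Structures using (IsEquivalence)
open import Relation.Nullary.Decidable using (does; dec-true; dec-false; does-⇔)
open import Relation.Nullary.Negation.Core using (¬_)
open import Relation.Unary using (Pred; Decidable)

-- Algebra of formal power series.

module SeriesProperties {c ℓ₁ ℓ₂ ℓ₃} (F : OrderedField c ℓ₁ ℓ₂ ℓ₃) where
  open OrderedField F hiding (_<_; _≤_)
  open PowerSeries F

  commutativeRing : CommutativeRing c ℓ₁
  commutativeRing = HeytingCommutativeRing.commutativeRing heytingCommutativeRing

  open HeytingProperties heytingCommutativeRing using (x-0≈x)
  open SemiringSolver (CommutativeRing.commutativeSemiring commutativeRing)
  open SetoidReasoning setoid

  [x-y]+y≈x : ∀ x y → x - y + y ≈ x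
  [x-y]+y≈x x y = trans (+-assoc x (- y) y) (trans (+-congˡ (-‿inverseˡ y)) (+-identityʳ x))

  *-cancelˡ-# : ∀ {a x y} → a # 0# → a * x ≈ a * y → x ≈ y
  *-cancelˡ-# {a} {x} {y} a#0 ax≈ay with #⇒invertible a#0
  ... | a⁻¹ , a⁻¹[a-0]≈1 , _ = begin
    x             ≈⟨ expand x ⟩
    a⁻¹ * (a * x) ≈⟨ *-congˡ ax≈ay ⟩
    a⁻¹ * (a * y) ≈⟨ expand y ⟨
    y             ∎
    where
    expand : ∀ z → z ≈ a⁻¹ * (a * z)
    expand z = begin
      z                    ≈⟨ *-identityˡ z ⟨
      -- Apartness from zero yields an inverse of the difference `a - 0#`, which is then simplified
      -- to `a`.
      1# * z               ≈⟨ *-congʳ a⁻¹[a-0]≈1 ⟨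
      a⁻¹ * (a - 0#) * z   ≈⟨ *-congʳ (*-congˡ (x-0≈x a)) ⟩
      a⁻¹ * a * z          ≈⟨ *-assoc a⁻¹ a z ⟩
      a⁻¹ * (a * z)        ∎

  -- The product satisfies (f ⊛ g) (suc k) = f 0 * g (suc k) + (tail f ⊛ g) k judgementally,
  -- so its laws follow by induction on k.

  tail : Series → Series
  tail f = f ∘ suc

  ⊛-cong : ∀ {f f′ g g′} → f ≋ f′ → g ≋ g′ → f ⊛ g ≋ f′ ⊛ g′
  ⊛-cong f≋ g≋ zero    = +-congʳ (*-cong (f≋ 0) (g≋ 0))
  ⊛-cong f≋ g≋ (suc k) = +-cong (*-cong (f≋ 0) (g≋ (suc k))) (⊛-cong (f≋ ∘ suc) g≋ k)

  ⊛-congˡ : ∀ f {g g′} → g ≋ g′ → f ⊛ g ≋ f ⊛ g′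
  ⊛-congˡ f = ⊛-cong {f} (λ _ → refl)

  ⊛-distribʳ : ∀ h f g → (f ⊕ g) ⊛ h ≋ f ⊛ h ⊕ g ⊛ h
  ⊛-distribʳ h f g zero =
    solve 3 (λ h₀ f₀ g₀ → (f₀ :+ g₀) :* h₀ :+ con 0
                       := (f₀ :* h₀ :+ con 0) :+ (g₀ :* h₀ :+ con 0))
      refl (h 0) (f 0) (g 0)
  ⊛-distribʳ h f g (suc k) = begin
    (f 0 + g 0) * h (suc k) + ((tail f ⊕ tail g) ⊛ h) k
      ≈⟨ +-congˡ (⊛-distribʳ h (tail f) (tail g) k) ⟩
    (f 0 + g 0) * h (suc k) + ((tail f ⊛ h) k + (tail g ⊛ h) k)
      ≈⟨ solve 5 (λ f₀ g₀ hₖ u v → (f₀ :+ g₀) :* hₖ :+ (u :+ v)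
                                := (f₀ :* hₖ :+ u) :+ (g₀ :* hₖ :+ v))
           refl (f 0) (g 0) (h (suc k)) ((tail f ⊛ h) k) ((tail g ⊛ h) k) ⟩
    (f ⊛ h) (suc k) + (g ⊛ h) (suc k) ∎

  scale-⊛ : ∀ a f g k → ((λ i → a * f i) ⊛ g) k ≈ a * (f ⊛ g) k
  scale-⊛ a f g zero =
    solve 3 (λ a f₀ g₀ → a :* f₀ :* g₀ :+ con 0 := a :* (f₀ :* g₀ :+ con 0))
      refl a (f 0) (g 0)
  scale-⊛ a f g (suc k) = begin
    a * f 0 * g (suc k) + ((λ i → a * tail f i) ⊛ g) k
      ≈⟨ +-congˡ (scale-⊛ a (tail f) g k) ⟩
    a * f 0 * g (suc k) + a * (tail f ⊛ g) k
      ≈⟨ solve 4 (λ a f₀ gₖ u → a :* f₀ :* gₖ :+ a :* u := a :* (f₀ :* gₖ :+ u))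
           refl a (f 0) (g (suc k)) ((tail f ⊛ g) k) ⟩
    a * (f ⊛ g) (suc k) ∎

  ⊛-assoc : ∀ f g h → (f ⊛ g) ⊛ h ≋ f ⊛ (g ⊛ h)
  ⊛-assoc f g h zero =
    solve 3 (λ f₀ g₀ h₀ → (f₀ :* g₀ :+ con 0) :* h₀ :+ con 0
                       := f₀ :* (g₀ :* h₀ :+ con 0) :+ con 0)
      refl (f 0) (g 0) (h 0)
  ⊛-assoc f g h (suc k) = begin
    -- The tail of `f ⊛ g` unfolds to `(λ i → f 0 * tail g i) ⊕ tail f ⊛ g`, so distributivity and
    -- scaling apply.
    (f 0 * g 0 + 0#) * h (suc k) + (((λ i → f 0 * tail g i) ⊕ tail f ⊛ g) ⊛ h) k
      ≈⟨ +-congˡ (⊛-distribʳ h (λ i → f 0 * tail g i) (tail f ⊛ g) k) ⟩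
    (f 0 * g 0 + 0#) * h (suc k) + (((λ i → f 0 * tail g i) ⊛ h) k + ((tail f ⊛ g) ⊛ h) k)
      ≈⟨ +-congˡ (+-cong (scale-⊛ (f 0) (tail g) h k) (⊛-assoc (tail f) g h k)) ⟩
    (f 0 * g 0 + 0#) * h (suc k) + (f 0 * (tail g ⊛ h) k + (tail f ⊛ (g ⊛ h)) k)
      ≈⟨ solve 5 (λ f₀ g₀ hₖ u v → (f₀ :* g₀ :+ con 0) :* hₖ :+ (f₀ :* u :+ v)
                                := f₀ :* (g₀ :* hₖ :+ u) :+ v)
           refl (f 0) (g 0) (h (suc k)) ((tail g ⊛ h) k) ((tail f ⊛ (g ⊛ h)) k) ⟩
    (f ⊛ (g ⊛ h)) (suc k) ∎

  -- Splits off the last term of the convolution instead of the first. Reversing the factors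
  -- exchanges the two, which gives commutativity.
  ⊛-suc-last : ∀ f g k → (f ⊛ g) (suc k) ≈ f (suc k) * g 0 + (f ⊛ tail g) k
  ⊛-suc-last f g zero =
    solve 4 (λ f₀ f₁ g₀ g₁ → f₀ :* g₁ :+ (f₁ :* g₀ :+ con 0)
                          := f₁ :* g₀ :+ (f₀ :* g₁ :+ con 0))
      refl (f 0) (f 1) (g 0) (g 1)
  ⊛-suc-last f g (suc k) = begin
    f 0 * g (2 ℕ.+ k) + (tail f ⊛ g) (suc k)
      ≈⟨ +-congˡ (⊛-suc-last (tail f) g k) ⟩
    f 0 * g (2 ℕ.+ k) + (f (2 ℕ.+ k) * g 0 + (tail f ⊛ tail g) k)
      ≈⟨ solve 3 (λ a b u → a :+ (b :+ u) := b :+ (a :+ u)) refl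
           (f 0 * g (2 ℕ.+ k)) (f (2 ℕ.+ k) * g 0) ((tail f ⊛ tail g) k) ⟩
    f (2 ℕ.+ k) * g 0 + (f ⊛ tail g) (suc k) ∎

  ⊛-comm : ∀ f g → f ⊛ g ≋ g ⊛ f
  ⊛-comm f g zero    = +-congʳ (*-comm (f 0) (g 0))
  ⊛-comm f g (suc k) = begin
    f 0 * g (suc k) + (tail f ⊛ g) k ≈⟨ +-cong (*-comm (f 0) (g (suc k))) (⊛-comm (tail f) g k) ⟩
    g (suc k) * f 0 + (g ⊛ tail f) k ≈⟨ ⊛-suc-last g f k ⟨
    (g ⊛ f) (suc k)                  ∎

  -- Stated for `λ _ → 0#` because the tail of a constant series reduces to it; `const 0#` agrees
  -- with it only pointwise.
  0-⊛ : ∀ f k → ((λ _ → 0#) ⊛ f) k ≈ 0#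
  0-⊛ f zero    = trans (+-identityʳ _) (zeroˡ (f 0))
  0-⊛ f (suc k) = trans (+-cong (zeroˡ (f (suc k))) (0-⊛ f k)) (+-identityʳ 0#)

  const-⊛ : ∀ a f k → (const a ⊛ f) k ≈ a * f k
  const-⊛ a f zero    = +-identityʳ (a * f 0)
  const-⊛ a f (suc k) = trans (+-congˡ (0-⊛ f k)) (+-identityʳ (a * f (suc k)))

  const-* : ∀ a b → const a ⊛ const b ≋ const (a * b)
  const-* a b zero    = const-⊛ a (const b) 0
  const-* a b (suc k) = trans (const-⊛ a (const b) (suc k)) (zeroʳ a)

  const-0 : ∀ k → const 0# k ≈ 0#
  const-0 zero    = refl
  const-0 (suc _) = refl

  ⊛-identityˡ : ∀ f → const 1# ⊛ f ≋ f
  ⊛-identityˡ f k = trans (const-⊛ 1# f k) (*-identityˡ (f k))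

  ≋-isEquivalence : IsEquivalence _≋_
  ≋-isEquivalence = record
    { refl  = λ _ → refl
    ; sym   = λ f≋g k → sym (f≋g k)
    ; trans = λ f≋g g≋h k → trans (f≋g k) (g≋h k)
    }

  seriesSemiring : CommutativeSemiring c ℓ₁
  seriesSemiring = record
    { Carrier = Series
    ; _≈_ = _≋_
    ; _+_ = _⊕_
    ; _*_ = _⊛_
    ; 0# = const 0#
    ; 1# = const 1#
    ; isCommutativeSemiring = isCommutativeSemiringˡ record
      { +-isCommutativeMonoid = record
        { isMonoid = record
          { isSemigroup = record
            { isMagma = record
              { isEquivalence = ≋-isEquivalence
              ; ∙-cong = λ f≋ g≋ k → +-cong (f≋ k) (g≋ k)
              }
            ; assoc = λ f g h k → +-assoc (f k) (g k) (h k)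
            }
          ; identity =
              (λ f k → trans (+-congʳ (const-0 k)) (+-identityˡ (f k))) ,
              (λ f k → trans (+-congˡ (const-0 k)) (+-identityʳ (f k)))
          }
        ; comm = λ f g k → +-comm (f k) (g k)
        }
      ; *-isCommutativeMonoid = record
        { isMonoid = record
          { isSemigroup = record
            { isMagma = record
              { isEquivalence = ≋-isEquivalence
              ; ∙-cong = ⊛-cong
              }
            ; assoc = ⊛-assoc
            }
          ; identity = ⊛-identityˡ ,
                       (λ f k → trans (⊛-comm f (const 1#) k) (⊛-identityˡ f k))
          }
        ; comm = ⊛-comm
        }
      ; distribʳ = ⊛-distribʳ
      ; zeroˡ = λ f k →
          trans (const-⊛ 0# f k) (trans (zeroˡ (f k)) (sym (const-0 k)))
      }
    }

  -- Multiplication by monomials: shift and cancellation.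

  X-⊛-zero : ∀ f → (X ⊛ f) 0 ≈ 0#
  X-⊛-zero f = trans (+-identityʳ _) (zeroˡ (f 0))

  X-⊛-suc : ∀ f k → (X ⊛ f) (suc k) ≈ f k
  X-⊛-suc f k = begin
    0# * f (suc k) + (tail X ⊛ f) k ≈⟨ +-cong (zeroˡ (f (suc k))) (⊛-cong {g = f} tail-X (λ _ → refl) k) ⟩
    0# + (const 1# ⊛ f) k           ≈⟨ +-identityˡ _ ⟩
    (const 1# ⊛ f) k                ≈⟨ ⊛-identityˡ f k ⟩
    f k                             ∎
    where
    tail-X : tail X ≋ const 1#
    tail-X zero    = refl
    tail-X (suc _) = refl

  aX-⊛-zero : ∀ a f → (const a ⊛ X ⊛ f) 0 ≈ 0#
  aX-⊛-zero a f = begin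
    (const a ⊛ X ⊛ f) 0   ≈⟨ ⊛-assoc (const a) X f 0 ⟩
    (const a ⊛ (X ⊛ f)) 0 ≈⟨ const-⊛ a (X ⊛ f) 0 ⟩
    a * (X ⊛ f) 0         ≈⟨ *-congˡ (X-⊛-zero f) ⟩
    a * 0#                ≈⟨ zeroʳ a ⟩
    0#                    ∎

  aX-⊛-suc : ∀ a f k → (const a ⊛ X ⊛ f) (suc k) ≈ a * f k
  aX-⊛-suc a f k = begin
    (const a ⊛ X ⊛ f) (suc k)   ≈⟨ ⊛-assoc (const a) X f (suc k) ⟩
    (const a ⊛ (X ⊛ f)) (suc k) ≈⟨ const-⊛ a (X ⊛ f) (suc k) ⟩
    a * (X ⊛ f) (suc k)         ≈⟨ *-congˡ (X-⊛-suc f k) ⟩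
    a * f k                     ∎

  -- Coefficient `k` of `f` reappears, multiplied by `a`, as coefficient `suc k` of the product;
  -- there `a` can be cancelled.
  aX-cancelˡ : ∀ {a f g} → a # 0# → const a ⊛ X ⊛ f ≋ const a ⊛ X ⊛ g → f ≋ g
  aX-cancelˡ {a} {f} {g} a#0 eq k = *-cancelˡ-# a#0
    (trans (sym (aX-⊛-suc a f k)) (trans (eq (suc k)) (aX-⊛-suc a g k)))

  aX↑-cancelˡ : ∀ {a f g} → a # 0# → ∀ n →
                (const a ⊛ X) ↑ n ⊛ f ≋ (const a ⊛ X) ↑ n ⊛ g → f ≋ g
  aX↑-cancelˡ {_} {f} {g} a#0 zero eq k =
    trans (sym (⊛-identityˡ f k)) (trans (eq k) (⊛-identityˡ g k))
  aX↑-cancelˡ {a} {f} {g} a#0 (suc n) eq = aX↑-cancelˡ a#0 n (aX-cancelˡ a#0 λ k →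
    trans (sym (⊛-assoc Y (Y ↑ n) f k)) (trans (eq k) (⊛-assoc Y (Y ↑ n) g k)))
    where
    Y : Series
    Y = const a ⊛ X

  -- Polynomials and degree bounds.

  IsPolynomial-resp-≋ : ∀ {f g} → f ≋ g → IsPolynomial f → IsPolynomial g
  IsPolynomial-resp-≋ f≋g (d , f>d) = d , λ k d<k → trans (sym (f≋g k)) (f>d k d<k)

  const-polynomial : ∀ a → IsPolynomial (const a)
  const-polynomial a = 0 , λ { (suc _) _ → refl }

  ⊖-polynomial : ∀ {f g} → IsPolynomial f → IsPolynomial g → IsPolynomial (f ⊖ g)
  ⊖-polynomial {f} {g} (d , f>d) (e , g>e) = d ℕ.⊔ e , λ k d⊔e<k → begin
    f k - g k ≈⟨ +-cong (f>d k (ℕₚ.≤-<-trans (ℕₚ.m≤m⊔n d e) d⊔e<k))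
                        (-‿cong (g>e k (ℕₚ.≤-<-trans (ℕₚ.m≤n⊔m d e) d⊔e<k))) ⟩
    0# - 0#   ≈⟨ -‿inverseʳ 0# ⟩
    0#        ∎

  aX-⊛-polynomial : ∀ a {f} → IsPolynomial f → IsPolynomial (const a ⊛ X ⊛ f)
  aX-⊛-polynomial a {f} (d , f>d) = suc d , λ
    { (suc k) (s≤s d<k) → trans (aX-⊛-suc a f k) (trans (*-congˡ (f>d k d<k)) (zeroʳ a)) }

  aX↑-⊛-polynomial : ∀ a n {f} → IsPolynomial f → IsPolynomial ((const a ⊛ X) ↑ n ⊛ f)
  aX↑-⊛-polynomial a zero    {f} f-poly =
    IsPolynomial-resp-≋ (λ k → sym (⊛-identityˡ f k)) f-poly
  aX↑-⊛-polynomial a (suc n) {f} f-poly =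
    IsPolynomial-resp-≋ (λ k → sym (⊛-assoc (const a ⊛ X) ((const a ⊛ X) ↑ n) f k))
      (aX-⊛-polynomial a (aX↑-⊛-polynomial a n f-poly))

module PileGameProperties {c ℓ₁ ℓ₂ ℓ₃} (F : OrderedField c ℓ₁ ℓ₂ ℓ₃)
                          (p : OrderedField.Carrier F) where
  open OrderedField F hiding (_<_; _≤_)
  open PowerSeries F
  open SeriesProperties F
  open PileGame F p
  open HeytingProperties heytingCommutativeRing using (1#0; #-congʳ; x-0≈x)
  open SemiringSolver seriesSemiring
  private
    module Series = CommutativeSemiring seriesSemiring
    module ≈R = SetoidReasoning setoid
    module ≋R = SetoidReasoning Series.setoid

  Y Z : Series
  Y = const p ⊛ X
  Z = const q ⊛ X

  -- Sums over outcomes.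

  sumOutcomes-cong : ∀ k {f g : Vec Choice k → Carrier} →
                     (∀ ω → f ω ≈ g ω) → sumOutcomes k f ≈ sumOutcomes k g
  sumOutcomes-cong zero    f≈g = f≈g []
  sumOutcomes-cong (suc k) f≈g =
    +-cong (sumOutcomes-cong k (f≈g ∘ (add ∷_))) (sumOutcomes-cong k (f≈g ∘ (remove ∷_)))

  sumOutcomes-0 : ∀ k → sumOutcomes k (λ _ → 0#) ≈ 0#
  sumOutcomes-0 zero    = refl
  sumOutcomes-0 (suc k) =
    trans (+-cong (sumOutcomes-0 k) (sumOutcomes-0 k)) (+-identityʳ 0#)

  *-sumOutcomes : ∀ a k (f : Vec Choice k → Carrier) →
                  sumOutcomes k (λ ω → a * f ω) ≈ a * sumOutcomes k f
  *-sumOutcomes a zero    f = refl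
  *-sumOutcomes a (suc k) f =
    trans (+-cong (*-sumOutcomes a k (f ∘ (add ∷_))) (*-sumOutcomes a k (f ∘ (remove ∷_))))
          (sym (distribˡ a _ _))

  Pr-impossible : ∀ {ℓ} k {A : Pred (Vec Choice k) ℓ} (A? : Decidable A) →
                  (∀ ω → ¬ A ω) → Pr k A? ≈ 0#
  Pr-impossible k A? ¬A = trans (sumOutcomes-cong k vanish) (sumOutcomes-0 k)
    where
    vanish : ∀ ω → (if does (A? ω) then outcomeProb ω else 0#) ≈ 0#
    vanish ω rewrite dec-false (A? ω) (¬A ω) = refl

  *-if : ∀ a b x → (if b then a * x else 0#) ≈ a * (if b then x else 0#)
  *-if a true  x = refl
  *-if a false x = sym (zeroʳ a)

  -- Conditioning on the first turn.

  G-end : ∀ n → G n n ≋ const 1#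
  G-end n zero rewrite dec-true (endsAt? n n []) done = refl
  -- A play of positive length begins with `turn`, which demands a start different from `n`.
  G-end n (suc k) = Pr-impossible (suc k) (endsAt? n n) λ { (_ ∷ _) (turn n≢n _) → n≢n ≡.refl }

  module _ {n s : ℕ} (s≢n : s ≢ n) where

    B-zero : B n 0 s ≈ 0#
    B-zero = Pr-impossible 0 (endsAt? n s) λ { [] done → s≢n ≡.refl }

    -- Since `s ≢ n`, the play does not end at once, so the two events are equivalent and their
    -- decisions have the same truth value.
    endsAt?-∷ : ∀ {k} c (ω : Vec Choice k) →
                does (endsAt? n s (c ∷ ω)) ≡ does (endsAt? n (move c s) ω)
    endsAt?-∷ c ω = does-⇔ (mk⇔ (λ { (turn _ e) → e }) (turn s≢n))
                           (endsAt? n s (c ∷ ω)) (endsAt? n (move c s) ω)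

    -- Outcomes are grouped by their first choice, whose probability factors out. At `s = 0`,
    -- `pred s` is again `0`, as the boundary rule demands.
    B-suc : ∀ k → B n (suc k) s ≈ p * B n k (suc s) + q * B n k (pred s)
    B-suc k = +-cong (after add) (after remove)
      where
      after : ∀ c → sumOutcomes k (λ ω → if does (endsAt? n s (c ∷ ω))
                                         then choiceProb c * outcomeProb ω else 0#)
                    ≈ choiceProb c * B n k (move c s)
      after c = trans (sumOutcomes-cong k step) (*-sumOutcomes (choiceProb c) k _)
        where
        step : ∀ ω → (if does (endsAt? n s (c ∷ ω)) then choiceProb c * outcomeProb ω else 0#)
                     ≈ choiceProb c * (if does (endsAt? n (move c s) ω) then outcomeProb ω else 0#)
        step ω rewrite endsAt?-∷ c ω = *-if (choiceProb c) _ (outcomeProb ω)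

  -- Stated for an arbitrary family `H`, so that the generating functions, their multiples and the
  -- explicit numerators can be compared as solutions of one linear system.
  FirstTurnEquation : ℕ → (ℕ → Series) → Set ℓ₁
  FirstTurnEquation n H = ∀ {s} → s ℕ.< n → H s ≋ Y ⊛ H (suc s) ⊕ Z ⊛ H (pred s)

  YZ-zero : ∀ f g → (Y ⊛ f ⊕ Z ⊛ g) 0 ≈ 0#
  YZ-zero f g = trans (+-cong (aX-⊛-zero p f) (aX-⊛-zero q g)) (+-identityʳ 0#)

  YZ-suc : ∀ f g k → (Y ⊛ f ⊕ Z ⊛ g) (suc k) ≈ p * f k + q * g k
  YZ-suc f g k = +-cong (aX-⊛-suc p f k) (aX-⊛-suc q g k)

  G-firstTurn : ∀ n → FirstTurnEquation n (G n)
  G-firstTurn n {s} s<n zero    = trans (B-zero (ℕₚ.<⇒≢ s<n)) (sym (YZ-zero (G n (suc s)) (G n (pred s))))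
  G-firstTurn n {s} s<n (suc k) = trans (B-suc (ℕₚ.<⇒≢ s<n) k)
    (sym (YZ-suc (G n (suc s)) (G n (pred s)) k))

  -- Linearity and uniqueness of solutions.

  firstTurn-scale : ∀ {n H} f → FirstTurnEquation n H → FirstTurnEquation n (λ s → f ⊛ H s)
  firstTurn-scale {n} {H} f eq {s} s<n = begin
    f ⊛ H s
      ≈⟨ ⊛-congˡ f (eq s<n) ⟩
    f ⊛ (Y ⊛ H (suc s) ⊕ Z ⊛ H (pred s))
      ≈⟨ solve 5 (λ f y z u v → f :* (y :* u :+ z :* v) := y :* (f :* u) :+ z :* (f :* v))
           Series.refl f Y Z (H (suc s)) (H (pred s)) ⟩
    Y ⊛ (f ⊛ H (suc s)) ⊕ Z ⊛ (f ⊛ H (pred s)) ∎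
    where open ≋R

  -- Induction on the index of the coefficient, for all `s` at once: `Y` and `Z` have no constant
  -- term, so coefficient `suc k` at `s` involves only coefficient `k` at the two neighbours.
  firstTurn-unique : ∀ {n H H′} → FirstTurnEquation n H → FirstTurnEquation n H′ →
                     H n ≋ H′ n → ∀ {s} → s ℕ.≤ n → H s ≋ H′ s
  firstTurn-unique {n} {H} {H′} eq eq′ end s≤n k = go k s≤n
    where
    go : ∀ k {s} → s ℕ.≤ n → H s k ≈ H′ s k
    go k s≤n with ℕₚ.m≤n⇒m<n∨m≡n s≤n
    go k       _ | inj₂ ≡.refl = end k
    go zero {s} _ | inj₁ s<n = begin
      H s 0                               ≈⟨ eq s<n 0 ⟩
      (Y ⊛ H (suc s) ⊕ Z ⊛ H (pred s)) 0   ≈⟨ YZ-zero (H (suc s)) (H (pred s)) ⟩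
      0#                                  ≈⟨ YZ-zero (H′ (suc s)) (H′ (pred s)) ⟨
      (Y ⊛ H′ (suc s) ⊕ Z ⊛ H′ (pred s)) 0 ≈⟨ eq′ s<n 0 ⟨
      H′ s 0                              ∎
      where open ≈R
    go (suc k) {s} s≤n | inj₁ s<n = begin
      H s (suc k)                             ≈⟨ eq s<n (suc k) ⟩
      (Y ⊛ H (suc s) ⊕ Z ⊛ H (pred s)) (suc k) ≈⟨ YZ-suc (H (suc s)) (H (pred s)) k ⟩
      p * H (suc s) k + q * H (pred s) k
        -- Both neighbours of `s` are still at most `n`, so the induction hypothesis covers them.
        ≈⟨ +-cong (*-congˡ (go k s<n)) (*-congˡ (go k (ℕₚ.≤⇒pred≤ s≤n))) ⟩
      p * H′ (suc s) k + q * H′ (pred s) k    ≈⟨ YZ-suc (H′ (suc s)) (H′ (pred s)) k ⟨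
      (Y ⊛ H′ (suc s) ⊕ Z ⊛ H′ (pred s)) (suc k) ≈⟨ eq′ s<n (suc k) ⟨
      H′ s (suc k)                            ∎
      where open ≈R

  -- Explicit denominators and numerators.

  denominator : ℕ → Series
  denominator 0             = const 1#
  denominator 1             = const 1# ⊖ Z
  -- This expands det(I - xM) along its last row, with M the tridiagonal transition matrix on the
  -- states `0` to `suc n`. The form `Z ⊛ (Y ⊛ _)` suits the shift lemmas.
  denominator (suc (suc n)) = denominator (suc n) ⊖ Z ⊛ (Y ⊛ denominator n)

  -- A play from `0` to `n` passes through `s`, so G n 0 = G s 0 · G n s; substituting Yⁿ / D n and
  -- Yˢ / D s for the series starting at `0` suggests this formula.
  numerator : ℕ → ℕ → Series
  numerator n s = Y ↑ (n ∸ s) ⊛ denominator s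

  denominator-polynomial : ∀ n → IsPolynomial (denominator n)
  denominator-polynomial 0 = const-polynomial 1#
  denominator-polynomial 1 = ⊖-polynomial (const-polynomial 1#)
    -- `Z` is treated as `Z ⊛ const 1#`, to which the degree bound for monomial multiples applies.
    (IsPolynomial-resp-≋ (Series.*-identityʳ Z) (aX-⊛-polynomial q (const-polynomial 1#)))
  denominator-polynomial (suc (suc n)) = ⊖-polynomial (denominator-polynomial (suc n))
    (aX-⊛-polynomial q (aX-⊛-polynomial p (denominator-polynomial n)))

  -- Every subtracted term is divisible by x. The constant term serves as the witness that the
  -- denominators are nonzero.
  denominator-0 : ∀ n → denominator n 0 ≈ 1#
  denominator-0 0 = refl
  denominator-0 1 = begin
    1# - Z 0 ≈⟨ +-congˡ (-‿cong (trans (const-⊛ q X 0) (zeroʳ q))) ⟩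
    1# - 0#  ≈⟨ x-0≈x 1# ⟩
    1#       ∎
    where open ≈R
  denominator-0 (suc (suc n)) = begin
    denominator (suc n) 0 - (Z ⊛ (Y ⊛ denominator n)) 0
      ≈⟨ +-cong (denominator-0 (suc n)) (-‿cong (aX-⊛-zero q (Y ⊛ denominator n))) ⟩
    1# - 0# ≈⟨ x-0≈x 1# ⟩
    1#      ∎
    where open ≈R

  denominator-nonZero : ∀ n → IsNonZero (denominator n)
  denominator-nonZero n = 0 , #-congʳ (sym (denominator-0 n)) 1#0

  numerator-end : ∀ n → numerator n n ≋ denominator n
  numerator-end n rewrite ℕₚ.n∸n≡0 n = ⊛-identityˡ (denominator n)

  -- Up to a power of `Y`, the equation at positive `s` is the recurrence for `denominator`. At
  -- `s = 0` the rule `pred 0 = 0` turns it into `1 = denominator 1 + Z`, which explains the initial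
  -- value.
  numerator-firstTurn : ∀ n → FirstTurnEquation n (numerator n)
  numerator-firstTurn (suc n) {zero} _ = begin
    Y ⊛ Y ↑ n ⊛ const 1#
      -- Reading the definition of `denominator 1` backwards as a sum leaves an identity without
      -- subtraction for the semiring solver.
      ≈⟨ ⊛-congˡ (Y ⊛ Y ↑ n) (λ k → sym ([x-y]+y≈x (const 1# k) (Z k))) ⟩
    Y ⊛ Y ↑ n ⊛ (denominator 1 ⊕ Z)
      ≈⟨ solve 4 (λ y z u d → y :* u :* (d :+ z)
                           := y :* (u :* d) :+ z :* (y :* u))
           Series.refl Y Z (Y ↑ n) (denominator 1) ⟩
    Y ⊛ (Y ↑ n ⊛ denominator 1) ⊕ Z ⊛ (Y ⊛ Y ↑ n)
      ≈⟨ (λ k → +-congˡ (⊛-congˡ Z (λ i → sym (Series.*-identityʳ (Y ⊛ Y ↑ n) i)) k)) ⟩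
    Y ⊛ (Y ↑ n ⊛ denominator 1) ⊕ Z ⊛ (Y ⊛ Y ↑ n ⊛ const 1#) ∎
    where open ≋R
  numerator-firstTurn (suc n) {suc s} (s≤s s<n)
    -- With `m = n ∸ suc s`, the exponents of `Y` at `s`, `suc s` and `suc (suc s)` become `m + 2`,
    -- `m + 1` and `m`.
    rewrite ℕₚ.+-∸-assoc 1 (ℕₚ.<⇒≤ s<n) | ℕₚ.+-∸-assoc 1 s<n = begin
    Y ⊛ V ⊛ denominator (suc s)
      ≈⟨ ⊛-congˡ (Y ⊛ V) (λ k → sym ([x-y]+y≈x (denominator (suc s) k) (ZYD k))) ⟩
    Y ⊛ V ⊛ (denominator (suc (suc s)) ⊕ ZYD)
      ≈⟨ solve 5 (λ y z v d₀ d₂ → y :* v :* (d₂ :+ z :* (y :* d₀))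
                               := y :* (v :* d₂) :+ z :* (y :* (y :* v) :* d₀))
           Series.refl Y Z V (denominator s) (denominator (suc (suc s))) ⟩
    Y ⊛ (V ⊛ denominator (suc (suc s))) ⊕ Z ⊛ (Y ⊛ (Y ⊛ V) ⊛ denominator s) ∎
    where
    open ≋R
    V ZYD : Series
    V = Y ↑ (n ∸ suc s)
    ZYD = Z ⊛ (Y ⊛ denominator s)

  denominator-fraction : ∀ {n s} → s ℕ.≤ n → denominator n ⊛ G n s ≋ numerator n s
  denominator-fraction {n} = firstTurn-unique
    (firstTurn-scale (denominator n) (G-firstTurn n)) (numerator-firstTurn n) end
    where
    open ≋R
    end : denominator n ⊛ G n n ≋ numerator n n
    end = begin
      denominator n ⊛ G n n   ≈⟨ ⊛-congˡ (denominator n) (G-end n) ⟩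
      denominator n ⊛ const 1# ≈⟨ Series.*-identityʳ (denominator n) ⟩
      denominator n           ≈⟨ numerator-end n ⟨
      numerator n n           ∎

  numerator-0 : ∀ n → numerator n 0 ≋ Y ↑ n
  numerator-0 n = Series.*-identityʳ (Y ↑ n)

  -- Existence and uniqueness of the normalised fraction.

  denominator-isNormalised : IsNormalisedFraction numerator denominator
  denominator-isNormalised = record
    { numerator-polynomial   = λ {n} {s} _ →
        aX↑-⊛-polynomial p (n ∸ s) (denominator-polynomial s)
    ; denominator-polynomial = denominator-polynomial
    ; denominator-nonZero    = denominator-nonZero
    ; fraction               = denominator-fraction
    ; normalised             = numerator-0
    }

  -- Cross-multiplication at `s = 0`, where both fractions have numerator `Y ↑ n`; `p # 0#` makes
  -- that power cancellable.
  denominator-unique : p # 0# → ∀ {P Q} → IsNormalisedFraction P Q → ∀ n → Q n ≋ denominator n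
  denominator-unique p#0 {P} {Q} frac n = aX↑-cancelˡ p#0 n (begin
    Y ↑ n ⊛ Q n                     ≈⟨ ⊛-cong {g = Q n} Yⁿ≋DG (λ _ → refl) ⟩
    denominator n ⊛ G n 0 ⊛ Q n
      ≈⟨ solve 3 (λ d g q → d :* g :* q := q :* g :* d)
           Series.refl (denominator n) (G n 0) (Q n) ⟩
    Q n ⊛ G n 0 ⊛ denominator n     ≈⟨ ⊛-cong {g = denominator n} QG≋Yⁿ (λ _ → refl) ⟩
    Y ↑ n ⊛ denominator n           ∎)
    where
    open ≋R
    open IsNormalisedFraction frac
    Yⁿ≋DG : Y ↑ n ≋ denominator n ⊛ G n 0
    Yⁿ≋DG k = sym (trans (denominator-fraction {n} z≤n k) (numerator-0 n k))
    QG≋Yⁿ : Q n ⊛ G n 0 ≋ Y ↑ n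
    QG≋Yⁿ k = trans (fraction z≤n k) (normalised n k)

  -- Reconciles the coefficient qp x² of the claimed recurrence with the product of `Z` and `Y` in
  -- the definition of `denominator`.
  qpX²≋ZY : ∀ f → const (q * p) ⊛ X ↑ 2 ⊛ f ≋ Z ⊛ (Y ⊛ f)
  qpX²≋ZY f = begin
    const (q * p) ⊛ X ↑ 2 ⊛ f
      ≈⟨ ⊛-cong {g = f} (⊛-cong {g = X ↑ 2} (λ k → sym (const-* q p k)) (λ _ → refl)) (λ _ → refl) ⟩
    const q ⊛ const p ⊛ X ↑ 2 ⊛ f
      ≈⟨ solve 4 (λ a b x f → a :* b :* (x :* (x :* con 1)) :* f := a :* x :* (b :* x :* f))
           (λ _ → refl) (const q) (const p) X f ⟩
    Z ⊛ (Y ⊛ f) ∎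
    where open ≋R

corollary3 : ∀ {c ℓ₁ ℓ₂ ℓ₃} (F : OrderedField c ℓ₁ ℓ₂ ℓ₃) →
    let open OrderedField F
        open PowerSeries F in
    (p : Carrier) → 0# < p → p ≤ 1# →
    let open PileGame F p in
    (∃₂ λ P Q → IsNormalisedFraction P Q) ×
    (∀ P Q → IsNormalisedFraction P Q →
      (∀ n → Q (suc (suc n)) ≋
             Q (suc n) ⊖ const (q * p) ⊛ X ↑ 2 ⊛ Q n) ×
      Q 0 ≋ const 1# ×
      Q 1 ≋ const 1# ⊖ const q ⊛ X)
corollary3 F p 0<p p≤1 = (numerator , denominator , denominator-isNormalised) ,
  λ P Q frac → let Q≋D = denominator-unique (#-sym (<⇒# 0<p)) frac in
    -- Once `Q` is replaced by `denominator`, the recurrence holds by definition, up to the form of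
    -- its coefficient.
    (λ n k → trans (Q≋D (suc (suc n)) k) (sym (+-cong (Q≋D (suc n) k) (-‿cong
      (trans (⊛-congˡ (const (q * p) ⊛ X ↑ 2) (Q≋D n) k) (qpX²≋ZY (denominator n) k)))))) ,
    Q≋D 0 ,
    Q≋D 1
  where
  open OrderedField F
  open PowerSeries F
  open SeriesProperties F
  open PileGame F p
  open PileGameProperties F p
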